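{- The fraction of functions $f:\mathbb{Z}_2^n\to\mathbb{Z}_2$ (among all $2^{2^n}$ such functions) that are $q$-locally correctable for $\varepsilon=2^{ -n}$ (i.e. from a single error) by an algorithm using $q<n/100$ non-adaptive queries tends to $0$ as $n\to\infty$.
   Context: For $f:\mathbb{Z}_2^n\to\mathbb{Z}_2$ and a permutation $\sigma\in\mathcal{S}_n$, let $f_\sigma(x_1,\dots,x_n)=f(x_{\sigma(1)},\dots,x_{\sigma(n)})$; such an $f_\sigma$ is called an isomorphism of $f$. Two functions $f,g:\mathbb{Z}_2^n\to\mathbb{Z}_2$ are $\varepsilon$-close if $\Pr_x[f(x)\ne g(x)]\le\varepsilon$ for uniformly random $x\in\mathbb{Z}_2^n$. Local correction: $f$ (known to the algorithm) is $q$-locally correctable for $\varepsilon>0$ if there is a randomized algorithm which, for every $\sigma\in\mathcal{S}_n$, every $g$ that is $\varepsilon$-close to $f_\sigma$, and every $x\in\mathbb{Z}_2^n$, given $x$ and black-box (query) access to $g$ (but not $\sigma$), outputs $f_\sigma(x)$ with probability at least $2/3$ using at most $q$ queries to $g$. The algorithm is non-adaptive if its query points do not depend on answers to earlier queries (they may depend on $f$, on $x$ and on the algorithm's randomness). -}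

module Defs where

open import Data.Bool using (Bool; true; false; _≟_)
open import Data.Fin using (Fin)
open import Data.Fin.Permutation using (Permutation′; _⟨$⟩ʳ_)
open import Data.Integer using (+_)
open import Data.List using (List; []; _∷_; length; map; filter; allFin; cartesianProductWith)
open import Data.List.Relation.Unary.All using (All)
import Data.List.Relation.Unary.Unique.Setoid as UniqueSetoid
open import Data.Nat as ℕ using (ℕ; zero; suc; NonZero; _^_)
open import Data.Nat.Properties using (m^n≢0)
open import Data.Product using (Σ; ∃)
open import Data.Rational using (ℚ; 0ℚ; _≤_; _<_; _/_)
open import Data.Vec as Vec using (Vec; lookup; tabulate)
open import Level using (0ℓ)
open import Relation.Binary.PropositionalEquality using (_≡_; _→-setoid_)
open import Relation.Nullary using (¬?)
open import Relation.Unary using (Pred; Decidable)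

-- ℤ₂ is represented by Bool (no ring structure is needed).
Point : ℕ → Set
Point n = Vec Bool n

BoolFun : ℕ → Set
BoolFun n = Point n → Bool

allPoints : ∀ n → List (Point n)
allPoints zero    = Vec.[] ∷ []
allPoints (suc n) = cartesianProductWith Vec._∷_ (false ∷ true ∷ []) (allPoints n)

infix 7 _/2^_

_/2^_ : ℕ → ℕ → ℚ
k /2^ m = _/_ (+ k) (2 ^ m) {{m^n≢0 2 m}}

PrPoint : ∀ {n} {P : Pred (Point n) 0ℓ} → Decidable P → ℚ
PrPoint {n} P? = length (filter P? (allPoints n)) /2^ n

PrFin : ∀ s .{{_ : NonZero s}} {P : Pred (Fin s) 0ℓ} → Decidable P → ℚ
PrFin s P? = + length (filter P? (allFin s)) / s

permute : ∀ {n} → BoolFun n → Permutation′ n → BoolFun n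
permute f σ x = f (tabulate (λ i → lookup x (σ ⟨$⟩ʳ i)))

Close : ∀ {n} → ℚ → BoolFun n → BoolFun n → Set
Close ε f g = PrPoint (λ x → ¬? (f x ≟ g x)) ≤ ε

-- The internal randomness is a uniform seed in a finite set of arbitrary size.
-- Non-adaptivity: the list of query points is a function of the input and the
-- seed only; the output may use the input, the seed and all the answers.
record NonAdaptiveAlgorithm (n q : ℕ) : Set where
  field
    seeds        : ℕ
    {{seeds≢0}}  : NonZero seeds
    queries      : Point n → Fin seeds → List (Point n)
    queries-≤    : ∀ x r → length (queries x r) ℕ.≤ q
    output       : Point n → Fin seeds → List Bool → Bool

  run : BoolFun n → Point n → Fin seeds → Bool
  run g x r = output x r (map g (queries x r))

-- The algorithm is chosen after f, so it may depend on f, but before σ and g.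
LocallyCorrectable : ∀ {n} → ℕ → ℚ → BoolFun n → Set
LocallyCorrectable {n} q ε f =
  Σ (NonAdaptiveAlgorithm n q) λ A → let open NonAdaptiveAlgorithm A in
    ∀ (σ : Permutation′ n) (g : BoolFun n) → Close ε g (permute f σ) →
    ∀ (x : Point n) →
    + 2 / 3 ≤ PrFin seeds (λ r → run g x r ≟ permute f σ x)

-- Functions are counted up to pointwise equality.
Distinct : ∀ {n} → List (BoolFun n) → Set
Distinct {n} = UniqueSetoid.Unique (Point n →-setoid Bool)

-- |{ f | P f }| / 2^(2^n) ≤ r for a P that need not come with a decision
-- procedure: every duplicate-free list of functions satisfying P has length at
-- most r · 2^(2^n).  In particular this applies to a list enumerating all of P.
FractionAtMost : ∀ {n} → Pred (BoolFun n) 0ℓ → ℚ → Set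
FractionAtMost {n} P r =
  ∀ (fs : List (BoolFun n)) → Distinct fs → All P fs → length fs /2^ (2 ^ n) ≤ r

FractionTendsToZero : (∀ n → Pred (BoolFun n) 0ℓ) → Set
FractionTendsToZero P =
  ∀ (δ : ℚ) → 0ℚ < δ → ∃ λ N → ∀ n → N ℕ.≤ n → FractionAtMost (P n) δ

{-# OPTIONS --safe #-}
-- Let x = 1010…, and let s ∈ {0,1}^⌊n/2⌋ act by swapping the pairs of coordinates
-- it selects.  Give the algorithm the input x and the function f_s with its value at
-- x overwritten by 0.  Averaging over s and the seed, for some fixed seed at least 2/3
-- of all s are answered correctly; this fixes the query list ys and the map from
-- answers to output.  For each query y ≠ x mark one pair in which y differs from
-- x.  On a subcube of s with all marked coordinates fixed, no query is moved to an image
-- of x, so the bits f(s·x) to be predicted are independent of the answers used to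
-- predict them.  Some such subcube, of size K ≥ 2^(⌊n/2⌋ - q), has success rate ≥ 2/3;
-- by the exponential moment E 2^(#successes) = (3/2)^K this happens for at most a
-- 2^(-K/32) fraction of f.  A union bound over the query lists, the output maps and
-- the subcubes, 2^(O(n²) + 2^(q+1)) choices in all, finishes the proof.

module Submission where

open import Defs
open import Data.Nat using (_*_; _<_)
open import Data.Product using (∃-syntax; _×_)

open import Data.Bool using (Bool; true; false; not; if_then_else_; _≟_)
open import Data.Fin using (Fin; zero; suc)
open import Data.Fin.Permutation using (Permutation′; _⟨$⟩ʳ_; id; lift₀; swap)
open import Data.List as List using (List; []; _∷_; _++_; length; map; filter; allFin; cartesianProductWith; cartesianProduct)
open import Data.List.Membership.Propositional using (_∈_)
open import Data.List.Membership.Propositional.Properties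
  using (∈-∃++; ∈-++⁺ˡ; ∈-++⁺ʳ; ∈-++⁻; ∈-map⁻; ∈-cartesianProductWith⁺; ∈-cartesianProductWith⁻; ∈-cartesianProduct⁺; ∈-cartesianProduct⁻; ∈-filter⁻)
open import Data.List.Properties using (length-++; length-map; length-tabulate; map-cong; map-cong-local)
open import Data.List.Relation.Binary.Subset.Propositional using (_⊆_)
open import Data.List.Relation.Unary.All as All using (All; []; _∷_)
open import Data.List.Relation.Unary.AllPairs as AllPairs using ([]; _∷_)
import Data.List.Relation.Unary.AllPairs.Properties as AllPairs
open import Data.List.Relation.Unary.Any using (here; there)
open import Data.List.Relation.Unary.Unique.Propositional using (Unique)
import Data.List.Relation.Unary.Unique.Propositional.Properties as Unique
open import Data.Integer as ℤ using (-[1+_])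
import Data.Integer.Properties as ℤ
open import Data.Nat as ℕ using (ℕ; NonZero; zero; suc; _+_; _∸_; _^_; _≤_; _≤?_; z≤n; s≤s; ⌊_/2⌋)
open import Data.Nat.DivMod using (m*n/n≡m; /-monoˡ-≤; m/n*n≤m)
open import Data.Nat.Properties hiding (_≟_)
open import Data.Nat.Solver using (module +-*-Solver)
open import Data.Product using (_,_; proj₁; proj₂; ∃)
open import Data.Rational as ℚ using (mkℚ; 0ℚ; _/_)
import Data.Rational.Properties as ℚ
open import Data.Rational.Unnormalised as ℚᵘ using (mkℚᵘ)
import Data.Rational.Unnormalised.Properties as ℚᵘ
open import Data.Sum using (inj₁; inj₂)
open import Data.Vec as Vec using (Vec; []; _∷_; lookup; tabulate; replicate)
open import Data.Vec.Properties using (≡-dec; ∷-injective; ∷-injectiveˡ; ∷-injectiveʳ)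
open import Function using (_∘_)
open import Relation.Binary.PropositionalEquality hiding (J)
open import Relation.Nullary using (Dec; yes; no; does; ¬?; contradiction)

open +-*-Solver using (solve; con; _:+_; _:*_; _:=_)

private variable
  A B C : Set

-- Finite sums

∑ : List A → (A → ℕ) → ℕ
∑ []       f = 0
∑ (x ∷ xs) f = f x + ∑ xs f

∑-mono-∈ : ∀ (xs : List A) {f g : A → ℕ} → (∀ {x} → x ∈ xs → f x ≤ g x) → ∑ xs f ≤ ∑ xs g
∑-mono-∈ []       f≤g = z≤n
∑-mono-∈ (x ∷ xs) f≤g = +-mono-≤ (f≤g (here refl)) (∑-mono-∈ xs (f≤g ∘ there))

∑-cong-∈ : ∀ (xs : List A) {f g : A → ℕ} → (∀ {x} → x ∈ xs → f x ≡ g x) → ∑ xs f ≡ ∑ xs g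
∑-cong-∈ []       f≡g = refl
∑-cong-∈ (x ∷ xs) f≡g = cong₂ _+_ (f≡g (here refl)) (∑-cong-∈ xs (f≡g ∘ there))

∑-cong : ∀ (xs : List A) {f g : A → ℕ} → (∀ x → f x ≡ g x) → ∑ xs f ≡ ∑ xs g
∑-cong xs f≡g = ∑-cong-∈ xs (λ {x} _ → f≡g x)

∑-+ : ∀ (xs : List A) (f g : A → ℕ) → ∑ xs (λ x → f x + g x) ≡ ∑ xs f + ∑ xs g
∑-+ []       f g = refl
∑-+ (x ∷ xs) f g = begin
  f x + g x + ∑ xs (λ x → f x + g x) ≡⟨ cong (f x + g x +_) (∑-+ xs f g) ⟩
  f x + g x + (∑ xs f + ∑ xs g)      ≡⟨ solve 4 (λ a b c d → a :+ b :+ (c :+ d) := a :+ c :+ (b :+ d)) refl (f x) (g x) _ _ ⟩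
  f x + ∑ xs f + (g x + ∑ xs g)      ∎
  where open ≡-Reasoning

∑-*ˡ : ∀ (xs : List A) c (f : A → ℕ) → ∑ xs (λ x → c * f x) ≡ c * ∑ xs f
∑-*ˡ []       c f = sym (*-zeroʳ c)
∑-*ˡ (x ∷ xs) c f = trans (cong (c * f x +_) (∑-*ˡ xs c f)) (sym (*-distribˡ-+ c (f x) _))

∑-const : ∀ (xs : List A) c → ∑ xs (λ _ → c) ≡ length xs * c
∑-const []       c = refl
∑-const (x ∷ xs) c = cong (c +_) (∑-const xs c)

length≡∑1 : ∀ (xs : List A) → length xs ≡ ∑ xs (λ _ → 1)
length≡∑1 xs = trans (sym (*-identityʳ _)) (sym (∑-const xs 1))

∑-swap : ∀ (xs : List A) (ys : List B) (f : A → B → ℕ) →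
         ∑ xs (λ x → ∑ ys (f x)) ≡ ∑ ys (λ y → ∑ xs (λ x → f x y))
∑-swap []       ys f = sym (trans (∑-const ys 0) (*-zeroʳ (length ys)))
∑-swap (x ∷ xs) ys f = trans (cong (∑ ys (f x) +_) (∑-swap xs ys f)) (sym (∑-+ ys (f x) _))

∑-++ : ∀ (xs ys : List A) (f : A → ℕ) → ∑ (xs ++ ys) f ≡ ∑ xs f + ∑ ys f
∑-++ []       ys f = refl
∑-++ (x ∷ xs) ys f = trans (cong (f x +_) (∑-++ xs ys f)) (sym (+-assoc (f x) _ _))

∑-map : ∀ (h : A → B) xs (f : B → ℕ) → ∑ (map h xs) f ≡ ∑ xs (f ∘ h)
∑-map h []       f = refl
∑-map h (x ∷ xs) f = cong (f (h x) +_) (∑-map h xs f)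

∑-cartesianProductWith : ∀ (h : A → B → C) xs ys (f : C → ℕ) →
  ∑ (cartesianProductWith h xs ys) f ≡ ∑ xs (λ x → ∑ ys (λ y → f (h x y)))
∑-cartesianProductWith h []       ys f = refl
∑-cartesianProductWith h (x ∷ xs) ys f = trans (∑-++ (map (h x) ys) _ f)
  (cong₂ _+_ (∑-map (h x) ys f) (∑-cartesianProductWith h xs ys f))

length-cartesianProductWith : ∀ (h : A → B → C) xs ys →
  length (cartesianProductWith h xs ys) ≡ length xs * length ys
length-cartesianProductWith h []       ys = refl
length-cartesianProductWith h (x ∷ xs) ys = trans (length-++ (map (h x) ys))
  (cong₂ _+_ (length-map (h x) ys) (length-cartesianProductWith h xs ys))

f≤∑ : ∀ {xs : List A} {x} (f : A → ℕ) → x ∈ xs → f x ≤ ∑ xs f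
f≤∑ f (here refl) = m≤m+n _ _
f≤∑ f (there x∈)  = m≤n⇒m≤o+n _ (f≤∑ f x∈)

-- Each entry of `xs` is cut out of `ys` at one occurrence; as `xs` has no duplicates, its other
-- entries are still found in what is left.
∑-⊆ : ∀ {xs ys : List A} (f : A → ℕ) → Unique xs → xs ⊆ ys → ∑ xs f ≤ ∑ ys f
∑-⊆ {xs = []} f _ _ = z≤n
∑-⊆ {xs = x ∷ xs} f (x∉ ∷ u) xs⊆ys with as , bs , refl ← ∈-∃++ (xs⊆ys (here refl)) = begin
  f x + ∑ xs f              ≤⟨ +-monoʳ-≤ (f x) (∑-⊆ f u rest) ⟩
  f x + ∑ (as ++ bs) f      ≡⟨ cong (f x +_) (∑-++ as bs f) ⟩
  f x + (∑ as f + ∑ bs f)   ≡⟨ solve 3 (λ a b c → a :+ (b :+ c) := b :+ (a :+ c)) refl (f x) (∑ as f) _ ⟩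
  ∑ as f + (f x + ∑ bs f)   ≡⟨ ∑-++ as (x ∷ bs) f ⟨
  ∑ (as ++ x ∷ bs) f        ∎
  where
  open ≤-Reasoning
  rest : xs ⊆ as ++ bs
  rest y∈xs with ∈-++⁻ as (xs⊆ys (there y∈xs))
  ... | inj₁ y∈as          = ∈-++⁺ˡ y∈as
  ... | inj₂ (here y≡x)    = contradiction (sym y≡x) (All.lookup x∉ y∈xs)
  ... | inj₂ (there y∈bs)  = ∈-++⁺ʳ as y∈bs

length-⊆ : ∀ {xs ys : List A} → Unique xs → xs ⊆ ys → length xs ≤ length ys
length-⊆ {xs = xs} {ys} u xs⊆ys = subst₂ _≤_ (sym (length≡∑1 xs)) (sym (length≡∑1 ys)) (∑-⊆ _ u xs⊆ys)

-- Averaging: were every `f y` above `g y`, adding up over a nonempty list would give the opposite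
-- strict inequality.
∑-≤⇒∃ : ∀ x (xs : List A) (f g : A → ℕ) → ∑ (x ∷ xs) f ≤ ∑ (x ∷ xs) g → ∃ λ y → f y ≤ g y
∑-≤⇒∃ x xs f g le with f x ≤? g x
... | yes fx≤gx = x , fx≤gx
∑-≤⇒∃ x []       f g le | no fx≰gx = contradiction (subst₂ _≤_ (+-identityʳ _) (+-identityʳ _) le) fx≰gx
∑-≤⇒∃ x (y ∷ ys) f g le | no fx≰gx = ∑-≤⇒∃ y ys f g
  (≮⇒≥ (λ lt → <⇒≱ (+-mono-< (≰⇒> fx≰gx) lt) le))

ind : {P : Set} → Dec P → ℕ
ind P? = if does P? then 1 else 0

ind-yes : {P : Set} (P? : Dec P) → P → ind P? ≡ 1
ind-yes (yes _) p = refl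
ind-yes (no ¬p) p = contradiction p ¬p

-- The pointwise form of Markov's inequality: off the event the left side is 0.
*-ind-≤ : ∀ {P : Set} {c d} (P? : Dec P) → (P → c ≤ d) → c * ind P? ≤ d
*-ind-≤         (yes p) c≤d = ≤-trans (≤-reflexive (*-identityʳ _)) (c≤d p)
*-ind-≤ {c = c} (no _)  c≤d = ≤-trans (≤-reflexive (*-zeroʳ c)) z≤n

length-filter≡∑ind : ∀ {P : A → Set} (P? : ∀ x → Dec (P x)) xs →
                     length (filter P? xs) ≡ ∑ xs (λ x → ind (P? x))
length-filter≡∑ind P? [] = refl
length-filter≡∑ind P? (x ∷ xs) with does (P? x)
... | true  = cong suc (length-filter≡∑ind P? xs)
... | false = length-filter≡∑ind P? xs

-- Enumerations

bools : List Bool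
bools = false ∷ true ∷ []

∈-bools : ∀ b → b ∈ bools
∈-bools false = here refl
∈-bools true  = there (here refl)

bools-unique : Unique bools
bools-unique = ((λ ()) ∷ []) ∷ [] ∷ []

∈-allPoints : ∀ {n} (x : Point n) → x ∈ allPoints n
∈-allPoints []      = here refl
∈-allPoints (b ∷ x) = ∈-cartesianProductWith⁺ _∷_ (∈-bools b) (∈-allPoints x)

allPoints-unique : ∀ n → Unique (allPoints n)
allPoints-unique zero    = [] ∷ []
allPoints-unique (suc n) = Unique.cartesianProductWith⁺ _∷_ ∷-injective bools-unique (allPoints-unique n)

length-allPoints : ∀ n → length (allPoints n) ≡ 2 ^ n
length-allPoints zero    = refl
length-allPoints (suc n) = trans (length-cartesianProductWith _∷_ bools (allPoints n)) (cong (2 *_) (length-allPoints n))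

_≟ᵖ_ : ∀ {n} (x y : Point n) → Dec (x ≡ y)
_≟ᵖ_ = ≡-dec _≟_

-- Truth tables of Boolean functions, so that functions can be compared with _≡_.
Table : ℕ → Set
Table zero    = Bool
Table (suc n) = Table n × Table n

eval : ∀ {n} → Table n → BoolFun n
eval {zero}  t         []          = t
eval {suc n} (t₀ , t₁) (false ∷ x) = eval t₀ x
eval {suc n} (t₀ , t₁) (true ∷ x)  = eval t₁ x

toTable : ∀ {n} → BoolFun n → Table n
toTable {zero}  f = f []
toTable {suc n} f = toTable (f ∘ (false ∷_)) , toTable (f ∘ (true ∷_))

eval-toTable : ∀ {n} (f : BoolFun n) x → eval (toTable f) x ≡ f x
eval-toTable f []          = refl
eval-toTable f (false ∷ x) = eval-toTable (f ∘ (false ∷_)) x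
eval-toTable f (true ∷ x)  = eval-toTable (f ∘ (true ∷_)) x

allTables : ∀ n → List (Table n)
allTables zero    = bools
allTables (suc n) = cartesianProduct (allTables n) (allTables n)

∈-allTables : ∀ {n} (t : Table n) → t ∈ allTables n
∈-allTables {zero}  t         = ∈-bools t
∈-allTables {suc n} (t₀ , t₁) = ∈-cartesianProduct⁺ (∈-allTables t₀) (∈-allTables t₁)

2^[2*n] : ∀ n → 2 ^ (2 * n) ≡ 2 ^ n * 2 ^ n
2^[2*n] n = trans (cong (λ k → 2 ^ (n + k)) (+-identityʳ n)) (^-distribˡ-+-* 2 n n)

length-allTables : ∀ n → length (allTables n) ≡ 2 ^ (2 ^ n)
length-allTables zero    = refl
length-allTables (suc n) = begin
  length (cartesianProduct (allTables n) (allTables n)) ≡⟨ length-cartesianProductWith _,_ (allTables n) (allTables n) ⟩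
  length (allTables n) * length (allTables n)           ≡⟨ cong₂ _*_ (length-allTables n) (length-allTables n) ⟩
  2 ^ (2 ^ n) * 2 ^ (2 ^ n)                             ≡⟨ 2^[2*n] (2 ^ n) ⟨
  2 ^ (2 ^ suc n)                                       ∎
  where open ≡-Reasoning

flipAt : ∀ {n} → Point n → Table n → Table n
flipAt []          t         = not t
flipAt (false ∷ z) (t₀ , t₁) = flipAt z t₀ , t₁
flipAt (true ∷ z)  (t₀ , t₁) = t₀ , flipAt z t₁

eval-flipAt-≡ : ∀ {n} (z : Point n) t → eval (flipAt z t) z ≡ not (eval t z)
eval-flipAt-≡ []          t = refl
eval-flipAt-≡ (false ∷ z) t = eval-flipAt-≡ z (proj₁ t)
eval-flipAt-≡ (true ∷ z)  t = eval-flipAt-≡ z (proj₂ t)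

eval-flipAt-≢ : ∀ {n} (z : Point n) t {y} → y ≢ z → eval (flipAt z t) y ≡ eval t y
eval-flipAt-≢ []          t {[]}        y≢z = contradiction refl y≢z
eval-flipAt-≢ (false ∷ z) t {false ∷ y} y≢z = eval-flipAt-≢ z (proj₁ t) (y≢z ∘ cong (false ∷_))
eval-flipAt-≢ (false ∷ z) t {true ∷ y}  y≢z = refl
eval-flipAt-≢ (true ∷ z)  t {false ∷ y} y≢z = refl
eval-flipAt-≢ (true ∷ z)  t {true ∷ y}  y≢z = eval-flipAt-≢ z (proj₂ t) (y≢z ∘ cong (true ∷_))

-- Flipping one bit permutes the tables. At the leaf it exchanges the two summands, and above the
-- leaf it acts on one half only.
∑-flipAt : ∀ {n} (z : Point n) (F : Table n → ℕ) → ∑ (allTables n) (F ∘ flipAt z) ≡ ∑ (allTables n) F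
∑-flipAt [] F = solve 2 (λ a b → a :+ (b :+ con 0) := b :+ (a :+ con 0)) refl (F true) (F false)
∑-flipAt {suc n} (b ∷ z) F = begin
  ∑ (allTables (suc n)) (F ∘ flipAt (b ∷ z))                                    ≡⟨ ∑-cartesianProductWith _,_ (allTables n) (allTables n) _ ⟩
  ∑ (allTables n) (λ t₀ → ∑ (allTables n) (λ t₁ → F (flipAt (b ∷ z) (t₀ , t₁)))) ≡⟨ halves b ⟩
  ∑ (allTables n) (λ t₀ → ∑ (allTables n) (λ t₁ → F (t₀ , t₁)))                  ≡⟨ ∑-cartesianProductWith _,_ (allTables n) (allTables n) F ⟨
  ∑ (allTables (suc n)) F                                                       ∎
  where
  open ≡-Reasoning
  halves : ∀ b → ∑ (allTables n) (λ t₀ → ∑ (allTables n) (λ t₁ → F (flipAt (b ∷ z) (t₀ , t₁)))) ≡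
                 ∑ (allTables n) (λ t₀ → ∑ (allTables n) (λ t₁ → F (t₀ , t₁)))
  halves false = ∑-flipAt z (λ t₀ → ∑ (allTables n) (λ t₁ → F (t₀ , t₁)))
  halves true  = ∑-cong (allTables n) (λ t₀ → ∑-flipAt z (λ t₁ → F (t₀ , t₁)))

-- Answer lists longer than q are read as their first q entries.
ListTable : ℕ → Set
ListTable zero    = Bool
ListTable (suc q) = Bool × ListTable q × ListTable q

evalList : ∀ {q} → ListTable q → List Bool → Bool
evalList {zero}  b           _            = b
evalList {suc q} (b , _ , _) []           = b
evalList {suc q} (_ , a , _) (false ∷ bs) = evalList a bs
evalList {suc q} (_ , _ , a) (true ∷ bs)  = evalList a bs

toListTable : ∀ q → (List Bool → Bool) → ListTable q
toListTable zero    h = h []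
toListTable (suc q) h = h [] , toListTable q (h ∘ (false ∷_)) , toListTable q (h ∘ (true ∷_))

evalList-toListTable : ∀ q h bs → length bs ≤ q → evalList (toListTable q h) bs ≡ h bs
evalList-toListTable zero    h []           _        = refl
evalList-toListTable (suc q) h []           _        = refl
evalList-toListTable (suc q) h (false ∷ bs) (s≤s le) = evalList-toListTable q (h ∘ (false ∷_)) bs le
evalList-toListTable (suc q) h (true ∷ bs)  (s≤s le) = evalList-toListTable q (h ∘ (true ∷_)) bs le

allListTables : ∀ q → List (ListTable q)
allListTables zero    = bools
allListTables (suc q) = cartesianProduct bools (cartesianProduct (allListTables q) (allListTables q))

∈-allListTables : ∀ {q} (a : ListTable q) → a ∈ allListTables q
∈-allListTables {zero}  b           = ∈-bools b
∈-allListTables {suc q} (b , l , r) =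
  ∈-cartesianProduct⁺ (∈-bools b) (∈-cartesianProduct⁺ (∈-allListTables l) (∈-allListTables r))

-- If N is the count for one length, the next one is 2N², so doubling the counts turns the recursion
-- into squaring.
2*length-allListTables : ∀ q → 2 * length (allListTables q) ≡ 2 ^ (2 ^ suc q)
2*length-allListTables zero    = refl
2*length-allListTables (suc q) = begin
  2 * length (allListTables (suc q))
    ≡⟨ cong (2 *_) (length-cartesianProductWith _,_ bools (cartesianProduct as as)) ⟩
  2 * (2 * length (cartesianProduct as as))
    ≡⟨ cong (λ k → 2 * (2 * k)) (length-cartesianProductWith _,_ as as) ⟩
  2 * (2 * (length as * length as))
    ≡⟨ solve 1 (λ k → con 2 :* (con 2 :* (k :* k)) := con 2 :* k :* (con 2 :* k)) refl (length as) ⟩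
  2 * length as * (2 * length as)
    ≡⟨ cong₂ _*_ (2*length-allListTables q) (2*length-allListTables q) ⟩
  2 ^ (2 ^ suc q) * 2 ^ (2 ^ suc q)
    ≡⟨ 2^[2*n] (2 ^ suc q) ⟨
  2 ^ (2 ^ suc (suc q)) ∎
  where
  open ≡-Reasoning
  as = allListTables q

queryLists : ∀ n → ℕ → List (List (Point n))
queryLists n zero    = [] ∷ []
queryLists n (suc q) = [] ∷ cartesianProductWith _∷_ (allPoints n) (queryLists n q)

∈-queryLists : ∀ {n q} (ys : List (Point n)) → length ys ≤ q → ys ∈ queryLists n q
∈-queryLists {q = zero}  []       _        = here refl
∈-queryLists {q = suc q} []       _        = here refl
∈-queryLists {q = suc q} (y ∷ ys) (s≤s le) =
  there (∈-cartesianProductWith⁺ _∷_ (∈-allPoints y) (∈-queryLists ys le))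

∈-queryLists⁻ : ∀ {n} q {ys : List (Point n)} → ys ∈ queryLists n q → length ys ≤ q
∈-queryLists⁻ zero    (here refl) = z≤n
∈-queryLists⁻ (suc q) (here refl) = z≤n
∈-queryLists⁻ {n} (suc q) (there ys∈)
  with _ , _ , _ , ys′∈ , refl ← ∈-cartesianProductWith⁻ _∷_ (allPoints n) (queryLists n q) ys∈
  = s≤s (∈-queryLists⁻ q ys′∈)

length-queryLists : ∀ n q → length (queryLists n q) ≤ 2 ^ (suc n * q)
length-queryLists n zero    = m^n>0 2 (suc n * 0)
length-queryLists n (suc q) = begin
  suc (length (cartesianProductWith _∷_ (allPoints n) (queryLists n q)))
    ≡⟨ cong suc (length-cartesianProductWith _∷_ (allPoints n) (queryLists n q)) ⟩
  suc (length (allPoints n) * length (queryLists n q))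
    ≡⟨ cong (λ k → suc (k * length (queryLists n q))) (length-allPoints n) ⟩
  suc (2 ^ n * length (queryLists n q))
    -- Both powers are at least 1, so a second copy of the product pays for the empty list. Hence
    -- the exponent `suc n` per query.
    ≤⟨ +-mono-≤ (*-mono-≤ (m^n>0 2 n) (m^n>0 2 (suc n * q))) (*-monoʳ-≤ (2 ^ n) (length-queryLists n q)) ⟩
  2 ^ n * 2 ^ (suc n * q) + 2 ^ n * 2 ^ (suc n * q)
    ≡⟨ solve 2 (λ a b → a :* b :+ a :* b := con 2 :* a :* b) refl (2 ^ n) (2 ^ (suc n * q)) ⟩
  2 ^ suc n * 2 ^ (suc n * q)
    ≡⟨ ^-distribˡ-+-* 2 (suc n) (suc n * q) ⟨
  2 ^ (suc n + suc n * q)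
    ≡⟨ cong (2 ^_) (*-suc (suc n) q) ⟨
  2 ^ (suc n * suc q) ∎
  where
  open ≤-Reasoning

-- Exponential moment of the number of correct predictions

hit : Bool → Bool → ℕ
hit p b = ind (p ≟ b)

2^hit+2^hit-not : ∀ p b → 2 ^ hit p b + 2 ^ hit p (not b) ≡ 3
2^hit+2^hit-not false false = refl
2^hit+2^hit-not false true  = refl
2^hit+2^hit-not true  false = refl
2^hit+2^hit-not true  true  = refl

module Prediction {n} {I : Set} (z : I → Point n) (predict : I → Table n → Bool) where

  score : List I → Table n → ℕ
  score is t = ∑ is (λ i → hit (predict i t) (eval t (z i)))

  -- Independence of uniform bits, stated as invariance: flipping any target bit, including the one
  -- to be predicted, leaves every prediction unchanged.
  Independent : List I → Set
  Independent is = ∀ {i j} → i ∈ is → j ∈ is → ∀ t → predict i (flipAt (z j) t) ≡ predict i t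

  -- Flipping the table at z i swaps success and failure of the prediction at i and
  -- affects nothing else, so the factor 2 ^ hit may be replaced by its mean 3/2.
  ∑-2^score : (∀ {i j} → z i ≡ z j → i ≡ j) → ∀ is → Unique is → Independent is →
              2 ^ length is * ∑ (allTables n) (λ t → 2 ^ score is t) ≡ 3 ^ length is * 2 ^ (2 ^ n)
  ∑-2^score z-inj [] _ _ = begin
    1 * ∑ (allTables n) (λ _ → 1)  ≡⟨ cong (1 *_) (length≡∑1 (allTables n)) ⟨
    1 * length (allTables n)       ≡⟨ cong (1 *_) (length-allTables n) ⟩
    1 * 2 ^ (2 ^ n)                ∎
    where open ≡-Reasoning
  ∑-2^score z-inj (i ∷ is) (i∉is ∷ u) indep = begin
    2 * 2 ^ k * ∑ ts F                        ≡⟨ solve 2 (λ a b → con 2 :* a :* b := a :* (b :+ b)) refl (2 ^ k) (∑ ts F) ⟩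
    2 ^ k * (∑ ts F + ∑ ts F)                 ≡⟨ cong (λ s → 2 ^ k * (∑ ts F + s)) (∑-flipAt (z i) F) ⟨
    2 ^ k * (∑ ts F + ∑ ts (F ∘ flipAt (z i))) ≡⟨ cong (2 ^ k *_) (∑-+ ts F (F ∘ flipAt (z i))) ⟨
    2 ^ k * ∑ ts (λ t → F t + F (flipAt (z i) t)) ≡⟨ cong (2 ^ k *_) (∑-cong ts pair) ⟩
    2 ^ k * ∑ ts (λ t → 3 * G t)              ≡⟨ cong (2 ^ k *_) (∑-*ˡ ts 3 G) ⟩
    2 ^ k * (3 * ∑ ts G)                      ≡⟨ solve 2 (λ a b → a :* (con 3 :* b) := con 3 :* (a :* b)) refl (2 ^ k) (∑ ts G) ⟩
    3 * (2 ^ k * ∑ ts G)                      ≡⟨ cong (3 *_) (∑-2^score z-inj is u (λ p q → indep (there p) (there q))) ⟩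
    3 * (3 ^ k * 2 ^ (2 ^ n))                 ≡⟨ *-assoc 3 (3 ^ k) _ ⟨
    3 * 3 ^ k * 2 ^ (2 ^ n)                   ∎
    where
    open ≡-Reasoning
    k = length is
    ts = allTables n
    F G : Table n → ℕ
    F t = 2 ^ score (i ∷ is) t
    G t = 2 ^ score is t
    score-flip : ∀ t → score is (flipAt (z i) t) ≡ score is t
    -- The targets are distinct, so the flip at `z i` leaves the other target bits alone.
    score-flip t = ∑-cong-∈ is λ j∈is → cong₂ hit (indep (there j∈is) (here refl) t)
      (eval-flipAt-≢ (z i) t (λ zj≡zi → All.lookup i∉is j∈is (sym (z-inj zj≡zi))))
    hit-flip : ∀ t → hit (predict i (flipAt (z i) t)) (eval (flipAt (z i) t) (z i)) ≡ hit (predict i t) (not (eval t (z i)))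
    hit-flip t = cong₂ hit (indep (here refl) (here refl) t) (eval-flipAt-≡ (z i) t)
    pair : ∀ t → F t + F (flipAt (z i) t) ≡ 3 * G t
    pair t = begin
      2 ^ (hit p b + s) + 2 ^ score (i ∷ is) (flipAt (z i) t)
        ≡⟨ cong (λ e → 2 ^ (hit p b + s) + 2 ^ e) (cong₂ _+_ (hit-flip t) (score-flip t)) ⟩
      2 ^ (hit p b + s) + 2 ^ (hit p (not b) + s)
        ≡⟨ cong₂ _+_ (^-distribˡ-+-* 2 (hit p b) s) (^-distribˡ-+-* 2 (hit p (not b)) s) ⟩
      2 ^ hit p b * 2 ^ s + 2 ^ hit p (not b) * 2 ^ s
        ≡⟨ *-distribʳ-+ (2 ^ s) (2 ^ hit p b) (2 ^ hit p (not b)) ⟨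
      (2 ^ hit p b + 2 ^ hit p (not b)) * 2 ^ s
        ≡⟨ cong (_* 2 ^ s) (2^hit+2^hit-not p b) ⟩
      3 * 2 ^ s ∎
      where
      p = predict i t
      b = eval t (z i)
      s = score is t

  mostlyHit? : ∀ is t → Dec (2 * length is ≤ 3 * score is t)
  mostlyHit? is t = 2 * length is ≤? 3 * score is t

  -- The threshold `20 * L` is rounded down from two thirds of `32 * L` and still exceeds by `L` the
  -- `19 * L` that the exponential moment costs.
  mostlyHit⇒≤score : ∀ is t L → length is ≡ 32 * L → 2 * length is ≤ 3 * score is t → 20 * L ≤ score is t
  mostlyHit⇒≤score is t L len le = *-cancelˡ-≤ 3 (begin
    3 * (20 * L)   ≡⟨ *-assoc 3 20 L ⟨
    60 * L         ≤⟨ *-monoˡ-≤ L (≤ᵇ⇒≤ 60 64 _) ⟩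
    64 * L         ≡⟨ *-assoc 2 32 L ⟩
    2 * (32 * L)   ≡⟨ cong (2 *_) len ⟨
    2 * length is  ≤⟨ le ⟩
    3 * score is t ∎)
    where open ≤-Reasoning

  -- Markov's inequality for 2 ^ score; it gains because (3/2) ^ 32 ≤ 2 ^ 19.
  ∑-mostlyHit : (∀ {i j} → z i ≡ z j → i ≡ j) → ∀ is L → length is ≡ 32 * L → Unique is → Independent is →
                2 ^ L * ∑ (allTables n) (λ t → ind (mostlyHit? is t)) ≤ 2 ^ (2 ^ n)
  ∑-mostlyHit z-inj is L len u indep = *-cancelˡ-≤ (2 ^ (51 * L)) {{m^n≢0 2 (51 * L)}} (begin
    2 ^ (51 * L) * (2 ^ L * N)          ≡⟨ *-assoc (2 ^ (51 * L)) (2 ^ L) N ⟨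
    2 ^ (51 * L) * 2 ^ L * N            ≡⟨ cong (_* N) (^-distribˡ-+-* 2 (51 * L) L) ⟨
    -- 51 = 32 + 19 comes from `3 ^ 32 ≤ 2 ^ 51`. One more `L` makes 52 = 32 + 20: the denominator
    -- of the moment and the Markov threshold.
    2 ^ (51 * L + L) * N                ≡⟨ cong (λ e → 2 ^ e * N) (solve 1 (λ l → con 51 :* l :+ l := con 32 :* l :+ con 20 :* l) refl L) ⟩
    2 ^ (32 * L + 20 * L) * N           ≡⟨ cong (_* N) (^-distribˡ-+-* 2 (32 * L) (20 * L)) ⟩
    2 ^ (32 * L) * 2 ^ (20 * L) * N     ≡⟨ *-assoc (2 ^ (32 * L)) (2 ^ (20 * L)) N ⟩
    2 ^ (32 * L) * (2 ^ (20 * L) * N)   ≡⟨ cong (2 ^ (32 * L) *_) (∑-*ˡ (allTables n) (2 ^ (20 * L)) _) ⟨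
    2 ^ (32 * L) * ∑ (allTables n) (λ t → 2 ^ (20 * L) * ind (mostlyHit? is t))
                                        ≤⟨ *-monoʳ-≤ (2 ^ (32 * L)) (∑-mono-∈ (allTables n) (λ {t} _ → markov t)) ⟩
    2 ^ (32 * L) * ∑ (allTables n) (λ t → 2 ^ score is t)
                                        ≡⟨ cong (λ k → 2 ^ k * ∑ (allTables n) (λ t → 2 ^ score is t)) len ⟨
    2 ^ length is * ∑ (allTables n) (λ t → 2 ^ score is t)
                                        ≡⟨ ∑-2^score z-inj is u indep ⟩
    3 ^ length is * 2 ^ (2 ^ n)         ≡⟨ cong (λ k → 3 ^ k * 2 ^ (2 ^ n)) len ⟩
    3 ^ (32 * L) * 2 ^ (2 ^ n)          ≡⟨ cong (_* 2 ^ (2 ^ n)) (^-*-assoc 3 32 L) ⟨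
    (3 ^ 32) ^ L * 2 ^ (2 ^ n)          ≤⟨ *-monoˡ-≤ (2 ^ (2 ^ n)) (^-monoˡ-≤ L (≤ᵇ⇒≤ (3 ^ 32) (2 ^ 51) _)) ⟩
    (2 ^ 51) ^ L * 2 ^ (2 ^ n)          ≡⟨ cong (_* 2 ^ (2 ^ n)) (^-*-assoc 2 51 L) ⟩
    2 ^ (51 * L) * 2 ^ (2 ^ n)          ∎)
    where
    open ≤-Reasoning
    N = ∑ (allTables n) (λ t → ind (mostlyHit? is t))
    markov : ∀ t → 2 ^ (20 * L) * ind (mostlyHit? is t) ≤ 2 ^ score is t
    markov t = *-ind-≤ (mostlyHit? is t) (λ le → ^-monoʳ-≤ 2 (mostlyHit⇒≤score is t L len le))

-- Subcubes

-- `M` is a mask: `true` stands for a coordinate that is held fixed.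
AgreeOn : ∀ {m} → Vec Bool m → Vec Bool m → Vec Bool m → Set
AgreeOn M s s′ = ∀ i → lookup M i ≡ true → lookup s i ≡ lookup s′ i

subcube : ∀ {m} → Vec Bool m → Vec Bool m → List (Vec Bool m)
subcube []          []      = [] ∷ []
subcube (true ∷ M)  (b ∷ a) = map (b ∷_) (subcube M a)
subcube (false ∷ M) (_ ∷ a) = cartesianProductWith _∷_ bools (subcube M a)

#free : ∀ {m} → Vec Bool m → ℕ
#free []          = 0
#free (true ∷ M)  = #free M
#free (false ∷ M) = suc (#free M)

length-subcube : ∀ {m} (M a : Vec Bool m) → length (subcube M a) ≡ 2 ^ #free M
length-subcube []          []      = refl
length-subcube (true ∷ M)  (b ∷ a) = trans (length-map (b ∷_) (subcube M a)) (length-subcube M a)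
length-subcube (false ∷ M) (_ ∷ a) =
  trans (length-cartesianProductWith _∷_ bools (subcube M a)) (cong (2 *_) (length-subcube M a))

subcube-unique : ∀ {m} (M a : Vec Bool m) → Unique (subcube M a)
subcube-unique []          []      = [] ∷ []
subcube-unique (true ∷ M)  (b ∷ a) = Unique.map⁺ ∷-injectiveʳ (subcube-unique M a)
subcube-unique (false ∷ M) (_ ∷ a) = Unique.cartesianProductWith⁺ _∷_ ∷-injective bools-unique (subcube-unique M a)

∈-subcube⇒agree : ∀ {m} (M a : Vec Bool m) {s} → s ∈ subcube M a → AgreeOn M s a
∈-subcube⇒agree (true ∷ M) (b ∷ a) s∈ i Mi with s′ , s′∈ , refl ← ∈-map⁻ (b ∷_) s∈ with i
... | zero  = refl
... | suc j = ∈-subcube⇒agree M a s′∈ j Mi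
∈-subcube⇒agree (false ∷ M) (_ ∷ a) s∈ (suc i) Mi
  with _ , s′ , _ , s′∈ , refl ← ∈-cartesianProductWith⁻ _∷_ bools (subcube M a) s∈
  = ∈-subcube⇒agree M a s′∈ i Mi

∑-allPoints-suc : ∀ {m} (h : Vec Bool (suc m) → ℕ) →
  ∑ (allPoints (suc m)) h ≡ ∑ (allPoints m) (h ∘ (false ∷_)) + ∑ (allPoints m) (h ∘ (true ∷_))
∑-allPoints-suc {m} h = trans (∑-cartesianProductWith _∷_ bools (allPoints m) h)
  (cong (∑ (allPoints m) (h ∘ (false ∷_)) +_) (+-identityʳ _))

-- The subcubes with free coordinates given by M partition the cube, so some one
-- of them has at least the global average of h.
densest-subcube : ∀ {m} (M : Vec Bool m) (h : Vec Bool m → ℕ) →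
  ∃ λ a → 2 ^ #free M * ∑ (allPoints m) h ≤ 2 ^ m * ∑ (subcube M a) h
densest-subcube [] h = [] , ≤-refl
densest-subcube {suc m} (true ∷ M) h = choose (≤-total S₀ S₁)
  where
  open ≤-Reasoning
  F = 2 ^ #free M
  S₀ = ∑ (allPoints m) (h ∘ (false ∷_))
  S₁ = ∑ (allPoints m) (h ∘ (true ∷_))
  larger : ∀ b → S₀ + S₁ ≤ 2 * ∑ (allPoints m) (h ∘ (b ∷_)) →
           ∃ λ a → F * ∑ (allPoints (suc m)) h ≤ 2 ^ suc m * ∑ (subcube (true ∷ M) a) h
  larger b le with a , ih ← densest-subcube M (h ∘ (b ∷_)) = b ∷ a , (begin
    F * ∑ (allPoints (suc m)) h                ≡⟨ cong (F *_) (∑-allPoints-suc h) ⟩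
    F * (S₀ + S₁)                              ≤⟨ *-monoʳ-≤ F le ⟩
    F * (2 * S)                                ≡⟨ solve 2 (λ x y → x :* (con 2 :* y) := con 2 :* (x :* y)) refl F S ⟩
    2 * (F * S)                                ≤⟨ *-monoʳ-≤ 2 ih ⟩
    2 * (2 ^ m * ∑ (subcube M a) (h ∘ (b ∷_))) ≡⟨ *-assoc 2 (2 ^ m) _ ⟨
    2 ^ suc m * ∑ (subcube M a) (h ∘ (b ∷_))   ≡⟨ cong (2 ^ suc m *_) (∑-map (b ∷_) (subcube M a) h) ⟨
    2 ^ suc m * ∑ (subcube (true ∷ M) (b ∷ a)) h ∎)
    where S = ∑ (allPoints m) (h ∘ (b ∷_))
  choose : _ → _
  choose (inj₁ S₀≤S₁) = larger true (+-mono-≤ S₀≤S₁ (m≤m+n S₁ 0))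
  choose (inj₂ S₁≤S₀) = larger false (+-monoʳ-≤ S₀ (m≤n⇒m≤n+o 0 S₁≤S₀))
densest-subcube {suc m} (false ∷ M) h with a , ih ← densest-subcube M (λ s → h (false ∷ s) + h (true ∷ s)) =
  -- The coordinate is free, so its entry in the base point is a dummy that `subcube` never reads.
  false ∷ a , (begin
    2 * F * ∑ (allPoints (suc m)) h     ≡⟨ cong (2 * F *_) (trans (∑-allPoints-suc h) (sym (∑-+ (allPoints m) _ _))) ⟩
    2 * F * ∑ (allPoints m) h′          ≡⟨ *-assoc 2 F _ ⟩
    2 * (F * ∑ (allPoints m) h′)        ≤⟨ *-monoʳ-≤ 2 ih ⟩
    2 * (2 ^ m * ∑ (subcube M a) h′)    ≡⟨ *-assoc 2 (2 ^ m) _ ⟨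
    2 ^ suc m * ∑ (subcube M a) h′      ≡⟨ cong (2 ^ suc m *_) (∑-+ (subcube M a) _ _) ⟩
    2 ^ suc m * (∑ (subcube M a) (h ∘ (false ∷_)) + ∑ (subcube M a) (h ∘ (true ∷_)))
      ≡⟨ cong (λ e → 2 ^ suc m * (∑ (subcube M a) (h ∘ (false ∷_)) + e)) (+-identityʳ _) ⟨
    2 ^ suc m * (∑ (subcube M a) (h ∘ (false ∷_)) + (∑ (subcube M a) (h ∘ (true ∷_)) + 0))
      ≡⟨ cong (2 ^ suc m *_) (∑-cartesianProductWith _∷_ bools (subcube M a) h) ⟨
    2 ^ suc m * ∑ (subcube (false ∷ M) (false ∷ a)) h ∎)
  where
  open ≤-Reasoning
  F = 2 ^ #free M
  h′ = λ s → h (false ∷ s) + h (true ∷ s)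

-- The permutations: swaps of adjacent pairs of coordinates

-- Every pair reads 10, so a swap always shows. For odd `n` one coordinate is left over, and no swap
-- moves it.
center : ∀ n → Point n
center 0             = []
center 1             = false ∷ []
center (suc (suc n)) = true ∷ false ∷ center n

pairSwaps : ∀ n → Vec Bool ⌊ n /2⌋ → Permutation′ n
pairSwaps 0             _           = id
pairSwaps 1             _           = id
pairSwaps (suc (suc n)) (false ∷ s) = lift₀ (lift₀ (pairSwaps n s))
pairSwaps (suc (suc n)) (true ∷ s)  = swap (pairSwaps n s)

-- Written so that `f (act n s y)` is by definition `permute f (pairSwaps n s) y`.
act : ∀ n → Vec Bool ⌊ n /2⌋ → Point n → Point n
act n s y = tabulate (λ i → lookup y (pairSwaps n s ⟨$⟩ʳ i))

act-tail : ∀ n b s u v y → Vec.tail (Vec.tail (act (suc (suc n)) (b ∷ s) (u ∷ v ∷ y))) ≡ act n s y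
act-tail n false s u v y = refl
act-tail n true  s u v y = refl

-- The first coordinate of each pair of the image tells whether that pair was swapped. So distinct
-- swap vectors have distinct target bits.
act-center-injective : ∀ n {s s′} → act n s (center n) ≡ act n s′ (center n) → s ≡ s′
act-center-injective 0 {[]} {[]} _ = refl
act-center-injective 1 {[]} {[]} _ = refl
act-center-injective (suc (suc n)) {false ∷ s} {false ∷ s′} eq =
  cong (false ∷_) (act-center-injective n (∷-injectiveʳ (∷-injectiveʳ eq)))
act-center-injective (suc (suc n)) {true ∷ s} {true ∷ s′} eq =
  cong (true ∷_) (act-center-injective n (∷-injectiveʳ (∷-injectiveʳ eq)))
act-center-injective (suc (suc n)) {false ∷ s} {true ∷ s′} eq with () ← ∷-injectiveˡ eq
act-center-injective (suc (suc n)) {true ∷ s} {false ∷ s′} eq with () ← ∷-injectiveˡ eq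

-- Marks the first pair in which y differs from the center: swaps that agree on
-- this pair never move y and the center to the same point.
mark : ∀ n → Point n → Vec Bool ⌊ n /2⌋ → Vec Bool ⌊ n /2⌋
mark 0             _                    M       = M
mark 1             _                    M       = M
mark (suc (suc n)) (true ∷ false ∷ y)   (c ∷ M) = c ∷ mark n y M
mark (suc (suc n)) (true ∷ true ∷ y)    (c ∷ M) = true ∷ M
mark (suc (suc n)) (false ∷ false ∷ y)  (c ∷ M) = true ∷ M
mark (suc (suc n)) (false ∷ true ∷ y)   (c ∷ M) = true ∷ M

mark-⊇ : ∀ n y M i → lookup M i ≡ true → lookup (mark n y M) i ≡ true
mark-⊇ (suc (suc n)) (true ∷ false ∷ y)  (c ∷ M) zero    Mi = Mi
mark-⊇ (suc (suc n)) (true ∷ false ∷ y)  (c ∷ M) (suc i) Mi = mark-⊇ n y M i Mi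
mark-⊇ (suc (suc n)) (true ∷ true ∷ y)   (c ∷ M) zero    Mi = refl
mark-⊇ (suc (suc n)) (true ∷ true ∷ y)   (c ∷ M) (suc i) Mi = Mi
mark-⊇ (suc (suc n)) (false ∷ false ∷ y) (c ∷ M) zero    Mi = refl
mark-⊇ (suc (suc n)) (false ∷ false ∷ y) (c ∷ M) (suc i) Mi = Mi
mark-⊇ (suc (suc n)) (false ∷ true ∷ y)  (c ∷ M) zero    Mi = refl
mark-⊇ (suc (suc n)) (false ∷ true ∷ y)  (c ∷ M) (suc i) Mi = Mi

#free-true∷ : ∀ {m} c (M : Vec Bool m) → #free (c ∷ M) ≤ suc (#free (true ∷ M))
#free-true∷ true  M = n≤1+n _
#free-true∷ false M = ≤-refl

-- A query fixes one pair at most, so it at most halves the number of points in the subcube.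
#free-mark : ∀ n y M → #free M ≤ suc (#free (mark n y M))
#free-mark 0             y                   M           = n≤1+n _
#free-mark 1             y                   M           = n≤1+n _
#free-mark (suc (suc n)) (true ∷ false ∷ y)  (true ∷ M)  = #free-mark n y M
#free-mark (suc (suc n)) (true ∷ false ∷ y)  (false ∷ M) = s≤s (#free-mark n y M)
#free-mark (suc (suc n)) (true ∷ true ∷ y)   (c ∷ M)     = #free-true∷ c M
#free-mark (suc (suc n)) (false ∷ false ∷ y) (c ∷ M)     = #free-true∷ c M
#free-mark (suc (suc n)) (false ∷ true ∷ y)  (c ∷ M)     = #free-true∷ c M

-- On the marked pair both swaps act by the same bijection, so different entries stay different.
-- Pairs before it, where `y` agrees with the center, are stripped off.
act≢act-center : ∀ n y M {s s′} → AgreeOn (mark n y M) s s′ → y ≢ center n → act n s y ≢ act n s′ (center n)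
act≢act-center 0 []          M          agree y≢c eq = y≢c refl
act≢act-center 1 (u ∷ [])    M          agree y≢c eq = y≢c eq
act≢act-center (suc (suc n)) (true ∷ false ∷ y) (c ∷ M) {b ∷ s} {b′ ∷ s′} agree y≢c eq =
  act≢act-center n y M (agree ∘ suc) (y≢c ∘ cong (λ y → true ∷ false ∷ y))
    (trans (sym (act-tail n b s true false y)) (trans (cong (Vec.tail ∘ Vec.tail) eq) (act-tail n b′ s′ true false (center n))))
act≢act-center (suc (suc n)) (true ∷ true ∷ y) (c ∷ M) {b ∷ s} {b′ ∷ s′} agree y≢c eq with b | b′ | agree zero refl
... | false | _ | refl with () ← ∷-injectiveˡ (∷-injectiveʳ eq)
... | true  | _ | refl with () ← ∷-injectiveˡ eq
act≢act-center (suc (suc n)) (false ∷ false ∷ y) (c ∷ M) {b ∷ s} {b′ ∷ s′} agree y≢c eq with b | b′ | agree zero refl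
... | false | _ | refl with () ← ∷-injectiveˡ eq
... | true  | _ | refl with () ← ∷-injectiveˡ (∷-injectiveʳ eq)
act≢act-center (suc (suc n)) (false ∷ true ∷ y) (c ∷ M) {b ∷ s} {b′ ∷ s′} agree y≢c eq with b | b′ | agree zero refl
... | false | _ | refl with () ← ∷-injectiveˡ eq
... | true  | _ | refl with () ← ∷-injectiveˡ eq

marks : ∀ n → List (Point n) → Vec Bool ⌊ n /2⌋
marks n []       = replicate ⌊ n /2⌋ false
marks n (y ∷ ys) = mark n y (marks n ys)

#free-replicate : ∀ m → #free (replicate m false) ≡ m
#free-replicate zero    = refl
#free-replicate (suc m) = cong suc (#free-replicate m)

#free-marks : ∀ n ys → ⌊ n /2⌋ ≤ length ys + #free (marks n ys)
#free-marks n []       = ≤-reflexive (sym (#free-replicate ⌊ n /2⌋))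
#free-marks n (y ∷ ys) = begin
  ⌊ n /2⌋                                        ≤⟨ #free-marks n ys ⟩
  length ys + #free (marks n ys)                 ≤⟨ +-monoʳ-≤ (length ys) (#free-mark n y (marks n ys)) ⟩
  length ys + suc (#free (mark n y (marks n ys))) ≡⟨ +-suc (length ys) _ ⟩
  suc (length ys) + #free (marks n (y ∷ ys))     ∎
  where open ≤-Reasoning

-- Marks only accumulate, so agreement on the final mask includes agreement on the mask built when
-- `y` was added.
marks-separate : ∀ n ys {s s′} → AgreeOn (marks n ys) s s′ →
                 ∀ {y} → y ∈ ys → y ≢ center n → act n s y ≢ act n s′ (center n)
marks-separate n (y ∷ ys) agree (here refl) = act≢act-center n y (marks n ys) agree
marks-separate n (y ∷ ys) agree (there y∈)  =
  marks-separate n ys (λ i Mi → agree i (mark-⊇ n y (marks n ys) i Mi)) y∈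

-- Correctable functions are predictable on a subcube

module _ {n : ℕ} where

  -- Overwriting the value at the center by a constant is at most one error, and
  -- makes querying the center itself useless.
  corrupt : BoolFun n → Vec Bool ⌊ n /2⌋ → BoolFun n
  corrupt f s y = if does (y ≟ᵖ center n) then false else f (act n s y)

  corrupt-cong : ∀ f g s y → (y ≢ center n → f (act n s y) ≡ g (act n s y)) → corrupt f s y ≡ corrupt g s y
  corrupt-cong f g s y eq with y ≟ᵖ center n
  ... | yes _   = refl
  ... | no y≢c = eq y≢c

  corrupt-≢ : ∀ f s y → corrupt f s y ≢ f (act n s y) → y ≡ center n
  corrupt-≢ f s y ne with y ≟ᵖ center n
  ... | yes y≡c = y≡c
  ... | no  _   = contradiction refl ne

  corrupt-errors : ∀ f s → length (filter (λ x → ¬? (corrupt f s x ≟ f (act n s x))) (allPoints n)) ≤ 1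
  corrupt-errors f s = length-⊆ {ys = center n ∷ []} (Unique.filter⁺ _ (allPoints-unique n))
    (λ {y} y∈ → here (corrupt-≢ f s y (proj₂ (∈-filter⁻ _ {xs = allPoints n} y∈))))

  module Predictor {q} (ys : List (Point n)) (a : ListTable q) =
    Prediction (λ s → act n s (center n)) (λ s t → evalList a (map (corrupt (eval t) s) ys))

  -- The targets in this subcube are images of the center. A query of the center is answered by a
  -- constant, and the marks keep every other query away from all of these images.
  independent : ∀ {q} ys (a : ListTable q) s₀ → Predictor.Independent ys a (subcube (marks n ys) s₀)
  independent ys a s₀ {s} {s′} s∈ s′∈ t = cong (evalList a) (map-cong-local (All.tabulate λ {y} y∈ys →
    corrupt-cong (eval (flipAt (act n s′ (center n)) t)) (eval t) s y λ y≢c → eval-flipAt-≢ (act n s′ (center n)) t (marks-separate n ys {s} {s′} agree y∈ys y≢c)))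
    where
    agree : AgreeOn (marks n ys) s s′
    agree i Mi = trans (∈-subcube⇒agree (marks n ys) s₀ s∈ i Mi) (sym (∈-subcube⇒agree (marks n ys) s₀ s′∈ i Mi))

  -- At most `q` coordinates are fixed, so the subcube has `32 * 2 ^ (F ∸ 5)` points with `F` at
  -- least `⌊ n /2⌋ ∸ q`. The 5 is the exponent of 32, the block length of the moment bound.
  few-predicted : ∀ {q} ys (a : ListTable q) s₀ → length ys ≤ q → 5 + q ≤ ⌊ n /2⌋ →
    2 ^ (2 ^ (⌊ n /2⌋ ∸ (5 + q))) * ∑ (allTables n) (λ t → ind (Predictor.mostlyHit? ys a (subcube (marks n ys) s₀) t)) ≤ 2 ^ (2 ^ n)
  few-predicted {q} ys a s₀ len≤q 5+q≤m = begin
    2 ^ (2 ^ (m ∸ (5 + q))) * N ≤⟨ *-monoˡ-≤ N (^-monoʳ-≤ 2 (^-monoʳ-≤ 2 e≤)) ⟩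
    2 ^ (2 ^ (F ∸ 5)) * N       ≤⟨ Predictor.∑-mostlyHit ys a (act-center-injective n) (subcube M s₀) (2 ^ (F ∸ 5)) len
                                     (subcube-unique M s₀) (independent ys a s₀) ⟩
    2 ^ (2 ^ n)                 ∎
    where
    open ≤-Reasoning
    m = ⌊ n /2⌋
    M = marks n ys
    F = #free M
    N = ∑ (allTables n) (λ t → ind (Predictor.mostlyHit? ys a (subcube M s₀) t))
    m≤q+F : m ≤ q + F
    m≤q+F = ≤-trans (#free-marks n ys) (+-monoˡ-≤ F len≤q)
    5≤F : 5 ≤ F
    5≤F = +-cancelˡ-≤ q 5 F (≤-trans (≤-reflexive (+-comm q 5)) (≤-trans 5+q≤m m≤q+F))
    e≤ : m ∸ (5 + q) ≤ F ∸ 5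
    e≤ = begin
      m ∸ (5 + q)       ≤⟨ ∸-monoˡ-≤ (5 + q) m≤q+F ⟩
      q + F ∸ (5 + q)   ≡⟨ cong (q + F ∸_) (+-comm 5 q) ⟩
      q + F ∸ (q + 5)   ≡⟨ [m+n]∸[m+o]≡n∸o q F 5 ⟩
      F ∸ 5             ∎
    len : length (subcube M s₀) ≡ 32 * 2 ^ (F ∸ 5)
    len = trans (length-subcube M s₀) (trans (cong (2 ^_) (sym (m+[n∸m]≡n 5≤F))) (^-distribˡ-+-* 2 5 (F ∸ 5)))

  -- The union bound over query lists, output maps and subcubes.

  Code : ℕ → Set
  Code q = List (Point n) × ListTable q × Vec Bool ⌊ n /2⌋

  codes : ∀ q → List (Code q)
  codes q = cartesianProduct (queryLists n q) (cartesianProduct (allListTables q) (allPoints ⌊ n /2⌋))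

  length-codes : ∀ q → length (codes q) ≤ 2 ^ (suc n * q + (2 ^ suc q + ⌊ n /2⌋))
  length-codes q = begin
    length (codes q)
      ≡⟨ length-cartesianProductWith _,_ (queryLists n q) _ ⟩
    length (queryLists n q) * length (cartesianProduct (allListTables q) (allPoints m))
      ≡⟨ cong (length (queryLists n q) *_) (length-cartesianProductWith _,_ (allListTables q) (allPoints m)) ⟩
    length (queryLists n q) * (length (allListTables q) * length (allPoints m))
      ≤⟨ *-mono-≤ (length-queryLists n q) (*-mono-≤ tables (≤-reflexive (length-allPoints m))) ⟩
    2 ^ (suc n * q) * (2 ^ (2 ^ suc q) * 2 ^ m)
      ≡⟨ cong (2 ^ (suc n * q) *_) (^-distribˡ-+-* 2 (2 ^ suc q) m) ⟨
    2 ^ (suc n * q) * 2 ^ (2 ^ suc q + m)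
      ≡⟨ ^-distribˡ-+-* 2 (suc n * q) (2 ^ suc q + m) ⟨
    2 ^ (suc n * q + (2 ^ suc q + m)) ∎
    where
    open ≤-Reasoning
    m = ⌊ n /2⌋
    tables : length (allListTables q) ≤ 2 ^ (2 ^ suc q)
    tables = ≤-trans (m≤m+n _ _) (≤-reflexive (2*length-allListTables q))

  predicted? : ∀ {q} ((ys , a , s₀) : Code q) t →
    Dec (2 * length (subcube (marks n ys) s₀) ≤ 3 * Predictor.score ys a (subcube (marks n ys) s₀) t)
  predicted? (ys , a , s₀) t = Predictor.mostlyHit? ys a (subcube (marks n ys) s₀) t

  -- The mask is computed from `ys`, so a code stores only the base point of the subcube. The bound
  -- on `length ys` places the code in the finite list `codes q`.
  Predicted : ℕ → BoolFun n → Set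
  Predicted q f = ∃ λ ((ys , a , s₀) : Code q) → length ys ≤ q ×
    2 * length (subcube (marks n ys) s₀) ≤ 3 * Predictor.score ys a (subcube (marks n ys) s₀) (toTable f)

  toTables-unique : ∀ {fs : List (BoolFun n)} → Distinct fs → Unique (map toTable fs)
  toTables-unique d = AllPairs.map⁺ (AllPairs.map (λ f≉g eq → f≉g (λ x →
    trans (sym (eval-toTable _ x)) (trans (cong (λ t → eval t x) eq) (eval-toTable _ x)))) d)

  -- Pairs of a table and a code that predicts it are counted in two ways: every listed function has
  -- such a code, and each code predicts few tables.
  count-predicted : ∀ q → 5 + q ≤ ⌊ n /2⌋ → ∀ fs → Distinct fs → All (Predicted q) fs →
    2 ^ (2 ^ (⌊ n /2⌋ ∸ (5 + q))) * length fs ≤ length (codes q) * 2 ^ (2 ^ n)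
  count-predicted q 5+q≤m fs d pred = begin
    E * length fs                                   ≡⟨ cong (E *_) (length-map toTable fs) ⟨
    E * length ts                                   ≡⟨ cong (E *_) (length≡∑1 ts) ⟩
    E * ∑ ts (λ _ → 1)                              ≤⟨ *-monoʳ-≤ E (∑-mono-∈ ts covered) ⟩
    -- Passing from the list to all tables uses that distinct functions have distinct tables.
    E * ∑ ts J                                      ≤⟨ *-monoʳ-≤ E (∑-⊆ J (toTables-unique d) (λ {t} _ → ∈-allTables t)) ⟩
    E * ∑ (allTables n) J                           ≡⟨ cong (E *_) (∑-swap (allTables n) (codes q) _) ⟩
    E * ∑ (codes q) (λ c → ∑ (allTables n) (λ t → ind (predicted? c t)))
                                                    ≡⟨ ∑-*ˡ (codes q) E _ ⟨
    ∑ (codes q) (λ c → E * ∑ (allTables n) (λ t → ind (predicted? c t)))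
                                                    ≤⟨ ∑-mono-∈ (codes q) few ⟩
    ∑ (codes q) (λ _ → 2 ^ (2 ^ n))                 ≡⟨ ∑-const (codes q) (2 ^ (2 ^ n)) ⟩
    length (codes q) * 2 ^ (2 ^ n)                  ∎
    where
    open ≤-Reasoning
    E = 2 ^ (2 ^ (⌊ n /2⌋ ∸ (5 + q)))
    ts = map toTable fs
    J : Table n → ℕ
    J t = ∑ (codes q) (λ c → ind (predicted? c t))
    covered : ∀ {t} → t ∈ ts → 1 ≤ J t
    covered t∈ with f , f∈ , refl ← ∈-map⁻ toTable t∈ with c@(ys , a , s₀) , len , hits ← All.lookup pred f∈ =
      ≤-trans (≤-reflexive (sym (ind-yes (predicted? c (toTable f)) hits)))
        (f≤∑ (λ c → ind (predicted? c (toTable f)))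
          (∈-cartesianProduct⁺ (∈-queryLists ys len) (∈-cartesianProduct⁺ (∈-allListTables a) (∈-allPoints s₀))))
    few : ∀ {c} → c ∈ codes q → E * ∑ (allTables n) (λ t → ind (predicted? c t)) ≤ 2 ^ (2 ^ n)
    few {ys , a , s₀} c∈ = few-predicted ys a s₀
      (∈-queryLists⁻ q (proj₁ (∈-cartesianProduct⁻ (queryLists n q) _ c∈))) 5+q≤m

-- Rationals

-- `_/_` reduces to lowest terms, so the comparison goes through unnormalised rationals, where it is
-- cross multiplication.
/-≤⁻ : ∀ a b c d .{{_ : NonZero b}} .{{_ : NonZero d}} → ℤ.+ a / b ℚ.≤ ℤ.+ c / d → a * d ≤ c * b
/-≤⁻ a (suc b) c (suc d) le = ℤ.drop‿+≤+ (subst₂ ℤ._≤_ (sym (ℤ.pos-* a (suc d))) (sym (ℤ.pos-* c (suc b)))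
  (ℚᵘ.drop-*≤* (ℚᵘ.≤-respˡ-≃ (ℚ.toℚᵘ-fromℚᵘ (mkℚᵘ (ℤ.+ a) b)) (ℚᵘ.≤-respʳ-≃ (ℚ.toℚᵘ-fromℚᵘ (mkℚᵘ (ℤ.+ c) d)) (ℚ.toℚᵘ-mono-≤ le)))))

/-≤⁺ : ∀ a b c d .{{_ : NonZero b}} .{{_ : NonZero d}} → a * d ≤ c * b → ℤ.+ a / b ℚ.≤ ℤ.+ c / d
/-≤⁺ a (suc b) c (suc d) le = ℚ.toℚᵘ-cancel-≤ (ℚᵘ.≤-respˡ-≃ (ℚᵘ.≃-sym (ℚ.toℚᵘ-fromℚᵘ (mkℚᵘ (ℤ.+ a) b)))
  (ℚᵘ.≤-respʳ-≃ (ℚᵘ.≃-sym (ℚ.toℚᵘ-fromℚᵘ (mkℚᵘ (ℤ.+ c) d)))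
    (ℚᵘ.*≤* (subst₂ ℤ._≤_ (ℤ.pos-* a (suc d)) (ℤ.pos-* c (suc b)) (ℤ.+≤+ le)))))

-- A positive numerator is at least 1, so the denominator of `δ` itself serves.
positive⇒≥1/d : ∀ δ → 0ℚ ℚ.< δ → ∃ λ d → ℤ.+ 1 / suc d ℚ.≤ δ
positive⇒≥1/d δ@(mkℚ (ℤ.+ suc p) d _) _   = d , subst (ℤ.+ 1 / suc d ℚ.≤_) (ℚ.↥p/↧p≡p δ) (/-≤⁺ 1 (suc d) (suc p) (suc d) (*-monoˡ-≤ (suc d) {1} {suc p} (s≤s z≤n)))
positive⇒≥1/d (mkℚ (ℤ.+ 0) d _)       0<δ with () ← ℚ.positive 0<δ
positive⇒≥1/d (mkℚ -[1+ p ] d _)    0<δ with () ← ℚ.positive 0<δ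

-- From a correction algorithm to a predictor with a fixed seed.

∃-allFin : ∀ k .{{_ : NonZero k}} (f g : Fin k → ℕ) → ∑ (allFin k) f ≤ ∑ (allFin k) g → ∃ λ i → f i ≤ g i
∃-allFin (suc k) = ∑-≤⇒∃ zero (List.tabulate suc)

-- The seed is fixed by averaging over seeds and swaps, then the subcube by averaging over the
-- parallel ones. The budget `Q` is separate from `q` because `q` may depend on `f`, whereas codes
-- are counted for one budget.
correctable⇒predicted : ∀ {n q Q} {f : BoolFun n} → q ≤ Q → LocallyCorrectable q (1 /2^ n) f → Predicted Q f
correctable⇒predicted {n} {q} {Q} {f} q≤Q (alg , correct) =
  let r , often = ∃-allFin seeds (λ _ → 2 * 2 ^ m) (λ r → 3 * ∑ (allPoints m) (λ s → H s r)) average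
  in fixedSeed r often
  where
  open NonAdaptiveAlgorithm alg
  open ≤-Reasoning
  m = ⌊ n /2⌋
  c = center n
  H : Vec Bool m → Fin seeds → ℕ
  H s r = hit (run (corrupt f s) c r) (f (act n s c))
  success : ∀ s → 2 * seeds ≤ 3 * ∑ (allFin seeds) (H s)
  success s = begin
    2 * seeds       ≤⟨ /-≤⁻ 2 3 (length successes) seeds (correct (pairSwaps n s) (corrupt f s) close c) ⟩
    length successes * 3 ≡⟨ *-comm (length successes) 3 ⟩
    3 * length successes ≡⟨ cong (3 *_) (length-filter≡∑ind _ (allFin seeds)) ⟩
    3 * ∑ (allFin seeds) (H s) ∎
    where
    successes = filter (λ r → run (corrupt f s) c r ≟ f (act n s c)) (allFin seeds)
    close : Close (1 /2^ n) (corrupt f s) (permute f (pairSwaps n s))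
    close = /-≤⁺ (length (filter (λ x → ¬? (corrupt f s x ≟ f (act n s x))) (allPoints n))) (2 ^ n) 1 (2 ^ n) {{m^n≢0 2 n}} {{m^n≢0 2 n}} (*-monoˡ-≤ (2 ^ n) (corrupt-errors f s))
  average : ∑ (allFin seeds) (λ _ → 2 * 2 ^ m) ≤ ∑ (allFin seeds) (λ r → 3 * ∑ (allPoints m) (λ s → H s r))
  average = begin
    ∑ (allFin seeds) (λ _ → 2 * 2 ^ m)                ≡⟨ ∑-const (allFin seeds) _ ⟩
    length (allFin seeds) * (2 * 2 ^ m)               ≡⟨ cong₂ (λ k l → k * (2 * l)) (length-tabulate {n = seeds} Function.id) (sym (length-allPoints m)) ⟩
    seeds * (2 * length (allPoints m))                ≡⟨ solve 2 (λ x y → x :* (con 2 :* y) := y :* (con 2 :* x)) refl seeds (length (allPoints m)) ⟩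
    length (allPoints m) * (2 * seeds)                ≡⟨ ∑-const (allPoints m) _ ⟨
    ∑ (allPoints m) (λ _ → 2 * seeds)                 ≤⟨ ∑-mono-∈ (allPoints m) (λ {s} _ → success s) ⟩
    ∑ (allPoints m) (λ s → 3 * ∑ (allFin seeds) (H s)) ≡⟨ ∑-*ˡ (allPoints m) 3 _ ⟩
    3 * ∑ (allPoints m) (λ s → ∑ (allFin seeds) (H s)) ≡⟨ cong (3 *_) (∑-swap (allPoints m) (allFin seeds) H) ⟩
    3 * ∑ (allFin seeds) (λ r → ∑ (allPoints m) (λ s → H s r)) ≡⟨ ∑-*ˡ (allFin seeds) 3 _ ⟨
    ∑ (allFin seeds) (λ r → 3 * ∑ (allPoints m) (λ s → H s r)) ∎
  module _ (r : Fin seeds) where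
    ys = queries c r
    -- The answer lists have length at most `Q`, so this finite table captures the output map.
    a = toListTable Q (output c r)
    M = marks n ys
    len≤Q : length ys ≤ Q
    len≤Q = ≤-trans (queries-≤ c r) q≤Q
    H≡hit : ∀ s → H s r ≡ hit (evalList a (map (corrupt (eval (toTable f)) s) ys)) (eval (toTable f) (act n s c))
    H≡hit s = sym (cong₂ hit
      (trans (evalList-toListTable Q (output c r) _ (≤-trans (≤-reflexive (length-map _ ys)) len≤Q))
        (cong (output c r) (map-cong (λ y → corrupt-cong (eval (toTable f)) f s y (λ _ → eval-toTable f (act n s y))) ys)))
      (eval-toTable f (act n s c)))
    fixedSeed : 2 * 2 ^ m ≤ 3 * ∑ (allPoints m) (λ s → H s r) → Predicted Q f
    -- The densest subcube for the mask of these queries keeps the success rate of at least 2/3.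
    fixedSeed often with s₀ , dense ← densest-subcube M (λ s → H s r) = (ys , a , s₀) , len≤Q , (begin
      2 * length (subcube M s₀)                              ≡⟨ cong (2 *_) (length-subcube M s₀) ⟩
      2 * 2 ^ #free M                                        ≤⟨ *-cancelˡ-≤ (2 ^ m) {{m^n≢0 2 m}} (begin
        2 ^ m * (2 * 2 ^ #free M)                            ≡⟨ solve 2 (λ x y → x :* (con 2 :* y) := y :* (con 2 :* x)) refl (2 ^ m) (2 ^ #free M) ⟩
        2 ^ #free M * (2 * 2 ^ m)                            ≤⟨ *-monoʳ-≤ (2 ^ #free M) often ⟩
        2 ^ #free M * (3 * ∑ (allPoints m) (λ s → H s r))    ≡⟨ solve 2 (λ x y → x :* (con 3 :* y) := con 3 :* (x :* y)) refl (2 ^ #free M) _ ⟩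
        3 * (2 ^ #free M * ∑ (allPoints m) (λ s → H s r))    ≤⟨ *-monoʳ-≤ 3 dense ⟩
        3 * (2 ^ m * ∑ (subcube M s₀) (λ s → H s r))         ≡⟨ solve 2 (λ x y → con 3 :* (x :* y) := x :* (con 3 :* y)) refl (2 ^ m) _ ⟩
        2 ^ m * (3 * ∑ (subcube M s₀) (λ s → H s r))         ∎) ⟩
      3 * ∑ (subcube M s₀) (λ s → H s r)                     ≡⟨ cong (3 *_) (∑-cong (subcube M s₀) H≡hit) ⟩
      3 * Predictor.score ys a (subcube M s₀) (toTable f)    ∎)

-- Growth

-- Induction with `k = 12 + j`, starting from 2704 ≤ 4096: at each step the right side doubles and
-- the left side grows by less.
16*[1+k]²≤2^k : ∀ j → 16 * ((13 + j) * (13 + j)) ≤ 2 ^ (12 + j)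
16*[1+k]²≤2^k zero    = ≤ᵇ⇒≤ (16 * (13 * 13)) (2 ^ 12) _
16*[1+k]²≤2^k (suc j) = begin
  -- The added term is 16 times 2(13 + j)² - (14 + j)².
  16 * ((13 + suc j) * (13 + suc j))              ≤⟨ m≤m+n _ (16 * (142 + 24 * j + j * j)) ⟩
  16 * ((13 + suc j) * (13 + suc j)) + 16 * (142 + 24 * j + j * j)
    ≡⟨ solve 1 (λ j → con 16 :* ((con 13 :+ (con 1 :+ j)) :* (con 13 :+ (con 1 :+ j))) :+ con 16 :* (con 142 :+ con 24 :* j :+ j :* j)
                   := con 2 :* (con 16 :* ((con 13 :+ j) :* (con 13 :+ j)))) refl j ⟩
  2 * (16 * ((13 + j) * (13 + j)))                ≤⟨ *-monoʳ-≤ 2 (16*[1+k]²≤2^k j) ⟩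
  2 * 2 ^ (12 + j)                                ≡⟨ cong (2 ^_) (+-suc 12 j) ⟨
  2 ^ (12 + suc j)                                ∎
  where
  open ≤-Reasoning

n≤1+2*⌊n/2⌋ : ∀ n → n ≤ 1 + 2 * ⌊ n /2⌋
n≤1+2*⌊n/2⌋ 0             = z≤n
n≤1+2*⌊n/2⌋ 1             = s≤s z≤n
n≤1+2*⌊n/2⌋ (suc (suc n)) = begin
  2 + n                        ≤⟨ +-monoʳ-≤ 2 (n≤1+2*⌊n/2⌋ n) ⟩
  2 + (1 + 2 * ⌊ n /2⌋)        ≡⟨ solve 1 (λ h → con 2 :+ (con 1 :+ con 2 :* h) := con 1 :+ con 2 :* (con 1 :+ h)) refl ⌊ n /2⌋ ⟩
  1 + 2 * ⌊ suc (suc n) /2⌋    ∎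
  where
  open ≤-Reasoning

2*⌊n/2⌋≤n : ∀ n → 2 * ⌊ n /2⌋ ≤ n
2*⌊n/2⌋≤n 0             = z≤n
2*⌊n/2⌋≤n 1             = z≤n
2*⌊n/2⌋≤n (suc (suc n)) = ≤-trans (≤-reflexive (*-suc 2 ⌊ n /2⌋)) (+-monoʳ-≤ 2 (2*⌊n/2⌋≤n n))

-- With `k` about n/4, each of the four terms of the cost exponent (query lists, output maps, base
-- points, and `d`) is at most `2 ^ k`, while the gain exponent is at least `2 ^ (2 + k)`.
module Asymptotics (n q d : ℕ) (100q≤n : 100 * q ≤ n) (50≤n : 50 ≤ n) (d≤n : d ≤ n) where
  open ≤-Reasoning

  m k : ℕ
  m = ⌊ n /2⌋
  k = ⌊ m /2⌋

  -- 50 halves to 25 and then, rounded down, to 12, where `16*[1+k]²≤2^k` starts.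
  12≤k : 12 ≤ k
  12≤k = ⌊n/2⌋-mono (⌊n/2⌋-mono 50≤n)

  m≤ : m ≤ 1 + 2 * k
  m≤ = n≤1+2*⌊n/2⌋ m

  n≤ : n ≤ 3 + 4 * k
  n≤ = begin
    n                     ≤⟨ n≤1+2*⌊n/2⌋ n ⟩
    1 + 2 * m             ≤⟨ +-monoʳ-≤ 1 (*-monoʳ-≤ 2 m≤) ⟩
    1 + 2 * (1 + 2 * k)   ≡⟨ solve 1 (λ k → con 1 :+ con 2 :* (con 1 :+ con 2 :* k) := con 3 :+ con 4 :* k) refl k ⟩
    3 + 4 * k             ∎

  7+q≤k : 7 + q ≤ k
  7+q≤k = *-cancelˡ-≤ 100 (begin
    100 * (7 + q)         ≡⟨ *-distribˡ-+ 100 7 q ⟩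
    700 + 100 * q         ≤⟨ +-monoʳ-≤ 700 (≤-trans 100q≤n n≤) ⟩
    700 + (3 + 4 * k)     ≡⟨ +-assoc 700 3 (4 * k) ⟨
    -- Here 703 ≤ 96 * 12 = 1152; the remaining `4 * k` came from bounding `n`.
    703 + 4 * k           ≤⟨ +-monoˡ-≤ (4 * k) (≤-trans (≤ᵇ⇒≤ 703 (96 * 12) _) (*-monoʳ-≤ 96 12≤k)) ⟩
    96 * k + 4 * k        ≡⟨ *-distribʳ-+ k 96 4 ⟨
    100 * k               ∎)

  2+k+[5+q]≤m : (2 + k) + (5 + q) ≤ m
  2+k+[5+q]≤m = begin
    (2 + k) + (5 + q)     ≡⟨ solve 2 (λ k q → (con 2 :+ k) :+ (con 5 :+ q) := k :+ (con 7 :+ q)) refl k q ⟩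
    k + (7 + q)           ≤⟨ +-monoʳ-≤ k 7+q≤k ⟩
    k + k                 ≡⟨ cong (k +_) (+-identityʳ k) ⟨
    2 * k                 ≤⟨ 2*⌊n/2⌋≤n m ⟩
    m                     ∎

  5+q≤m : 5 + q ≤ m
  5+q≤m = m+n≤o⇒n≤o (2 + k) 2+k+[5+q]≤m

  square≤ : 16 * (suc k * suc k) ≤ 2 ^ k
  square≤ = subst (λ k → 16 * (suc k * suc k) ≤ 2 ^ k) (m+[n∸m]≡n 12≤k) (16*[1+k]²≤2^k (k ∸ 12))

  linear≤ : 4 * suc k ≤ 2 ^ k
  linear≤ = begin
    4 * suc k             ≤⟨ *-mono-≤ (≤ᵇ⇒≤ 4 16 _) (m≤m*n (suc k) (suc k)) ⟩
    16 * (suc k * suc k)  ≤⟨ square≤ ⟩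
    2 ^ k                 ∎

  1+n≤ : suc n ≤ 4 * suc k
  1+n≤ = ≤-trans (s≤s n≤) (≤-reflexive (sym (*-suc 4 k)))

  n≤2^k : n ≤ 2 ^ k
  n≤2^k = ≤-trans (n≤1+n n) (≤-trans 1+n≤ linear≤)

  exponent≤ : suc n * q + (2 ^ suc q + m) + d ≤ 2 ^ (m ∸ (5 + q))
  exponent≤ = begin
    suc n * q + (2 ^ suc q + m) + d     ≤⟨ +-mono-≤ (+-mono-≤ queries≤ (+-mono-≤ answers≤ (≤-trans (⌊n/2⌋≤n n) n≤2^k))) (≤-trans d≤n n≤2^k) ⟩
    2 ^ k + (2 ^ k + 2 ^ k) + 2 ^ k     ≡⟨ solve 1 (λ x → x :+ (x :+ x) :+ x := con 2 :* (con 2 :* x)) refl (2 ^ k) ⟩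
    2 ^ (2 + k)                         ≤⟨ ^-monoʳ-≤ 2 (m+n≤o⇒m≤o∸n (2 + k) 2+k+[5+q]≤m) ⟩
    2 ^ (m ∸ (5 + q))                   ∎
    where
    q≤k : q ≤ k
    q≤k = m+n≤o⇒n≤o 7 7+q≤k
    queries≤ : suc n * q ≤ 2 ^ k
    queries≤ = begin
      suc n * q                   ≤⟨ *-mono-≤ 1+n≤ (≤-trans q≤k (≤-trans (n≤1+n k) (m≤n*m (suc k) 4))) ⟩
      4 * suc k * (4 * suc k)     ≡⟨ solve 1 (λ x → con 4 :* x :* (con 4 :* x) := con 16 :* (x :* x)) refl (suc k) ⟩
      16 * (suc k * suc k)        ≤⟨ square≤ ⟩
      2 ^ k                       ∎
    answers≤ : 2 ^ suc q ≤ 2 ^ k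
    answers≤ = ^-monoʳ-≤ 2 (≤-trans (+-monoˡ-≤ q (s≤s z≤n)) 7+q≤k)

-- The bound on the fraction and its limit.

n≤2^n : ∀ n → n ≤ 2 ^ n
n≤2^n zero    = z≤n
n≤2^n (suc n) = +-mono-≤ (m^n>0 2 n) (≤-trans (n≤2^n n) (m≤m+n _ 0))

fraction-bound : ∀ n q d → 100 * q ≤ n → 50 ≤ n → d ≤ n →
  ∀ (fs : List (BoolFun n)) → Distinct fs → All (Predicted q) fs → length fs * d ≤ 2 ^ (2 ^ n)
fraction-bound n q d 100q≤n 50≤n d≤n fs dist pred = *-cancelˡ-≤ E {{m^n≢0 2 (2 ^ (m ∸ (5 + q)))}} (begin
  E * (length fs * d)                     ≡⟨ *-assoc E (length fs) d ⟨
  -- Since `d ≤ 2 ^ d`, the factor `d` costs only `d` in the exponent, for which `exponent≤` leaves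
  -- room.
  E * length fs * d                       ≤⟨ *-mono-≤ (count-predicted q 5+q≤m fs dist pred) (n≤2^n d) ⟩
  length (codes {n} q) * T * 2 ^ d        ≤⟨ *-monoˡ-≤ (2 ^ d) (*-monoˡ-≤ T (length-codes {n} q)) ⟩
  2 ^ w * T * 2 ^ d                       ≡⟨ solve 3 (λ a b c → a :* b :* c := a :* c :* b) refl (2 ^ w) T (2 ^ d) ⟩
  2 ^ w * 2 ^ d * T                       ≡⟨ cong (_* T) (^-distribˡ-+-* 2 w d) ⟨
  2 ^ (w + d) * T                         ≤⟨ *-monoˡ-≤ T (^-monoʳ-≤ 2 exponent≤) ⟩
  E * T                                   ∎)
  where
  open Asymptotics n q d 100q≤n 50≤n d≤n
  open ≤-Reasoning
  E = 2 ^ (2 ^ (m ∸ (5 + q)))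
  T = 2 ^ (2 ^ n)
  w = suc n * q + (2 ^ suc q + m)

theorem1p4 : FractionTendsToZero (λ n f → ∃[ q ] (100 * q < n × LocallyCorrectable q (1 /2^ n) f))
-- From 50 on the growth estimates hold, and `suc d ≤ n` makes the fraction at most `1 / suc d`,
-- hence at most `δ`.
theorem1p4 δ 0<δ with d , 1/d≤δ ← positive⇒≥1/d δ 0<δ = 50 + suc d , λ n N≤n fs dist all →
  -- The budget n/100, rounded down, serves every `f` at once, since `100 * q < n` bounds each `q`
  -- by it.
  let predicted : ∀ {f} → ∃[ q ] (100 * q < n × LocallyCorrectable q (1 /2^ n) f) → Predicted (n ℕ./ 100) f
      predicted (q , 100q<n , lc) = correctable⇒predicted
        (≤-trans (≤-reflexive (sym (m*n/n≡m q 100))) (/-monoˡ-≤ 100 (≤-trans (≤-reflexive (*-comm q 100)) (<⇒≤ 100q<n)))) lc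
      bound = fraction-bound n (n ℕ./ 100) (suc d)
        (≤-trans (≤-reflexive (*-comm 100 (n ℕ./ 100))) (m/n*n≤m n 100))
        (m+n≤o⇒m≤o 50 N≤n) (m+n≤o⇒n≤o 50 N≤n) fs dist (All.map predicted all)
  in ℚ.≤-trans (/-≤⁺ (length fs) (2 ^ (2 ^ n)) 1 (suc d) {{m^n≢0 2 (2 ^ n)}} (≤-trans bound (≤-reflexive (sym (*-identityˡ _))))) 1/d≤δ
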